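{- Let $\mathbf{y}=(y_1,y_2,\dots,y_n)\in\mathbb{N}^n$, and define $\mathcal{W}(\mathbf{y})=\{w\in\mathbb{N}:(1^{n-1},w)\in\mathsf{PA}^{\mathrm{inv}}_n(\mathbf{y})\}$. (a) If $\mathbf{y}$ is non-constant (its entries are not all equal) and $w\in\mathcal{W}(\mathbf{y})$, then $w\le\sum_{j=1}^{n-1}y_j$. (b) We have $$\mathcal{W}(\mathbf{y})\subseteq\{1+\mathbf{b}^\top\mathbf{y}:\mathbf{b}\in\{0\}\times\{0,1\}^{n-1}\}\quad\text{and}\quad|\mathcal{W}(\mathbf{y})|\le 2^{n-1}.$$ (c) If $$y_j>\sum_{i=j+1}^{n}y_i\quad\text{for all }j\in[n-1],$$ then equality is achieved in (b), i.e. $\mathcal{W}(\mathbf{y})=\{1+\mathbf{b}^\top\mathbf{y}:\mathbf{b}\in\{0\}\times\{0,1\}^{n-1}\}$ and $|\mathcal{W}(\mathbf{y})|=2^{n-1}$. Moreover, $$|\mathsf{PA}^{\mathrm{inv}}_n(\mathbf{y})|=2^{n-1}n-n+1\quad\text{and}\quad|\mathsf{PA}^{\mathrm{inv},\uparrow}_n(\mathbf{y})|=2^{n-1}.$$ (d) Let $n\ge 2$. If equality is achieved in (b), i.e. $|\mathcal{W}(\mathbf{y})|=2^{n-1}$ (which forces equality in the inclusion as well), then $$y_1\ge y_2\quad\text{and}\quad y_j>\sum_{i=j+1}^{n}y_i\quad\text{for all }j\in[n-1]\setminus\{1\}.$$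
   Context: $\mathbb{N}=\{1,2,3,\dots\}$ and $[n]=\{1,\dots,n\}$ (with $[0]=\emptyset$). Let $\mathbf{y}=(y_1,\dots,y_n)\in\mathbb{N}^n$ and $m=\sum_{i=1}^n y_i$. Consider a one-way street with $m$ parking spots numbered $1,\dots,m$ and $n$ cars entering in order $1,2,\dots,n$, where car $i$ has length $y_i$ and prefers spot $x_i\in[m]$. Car $i$ drives to spot $x_i$ and parks in $x_i,x_i+1,\dots,x_i+y_i-1$ if these spots exist and are all unoccupied; otherwise it parks in the next $y_i$ contiguous available spots, i.e. it occupies $s,s+1,\dots,s+y_i-1$ for the smallest $s\ge x_i$ such that $s+y_i-1\le m$ and all these spots are unoccupied; if no such $s$ exists, parking fails. The vector $\mathbf{x}=(x_1,\dots,x_n)\in[m]^n$ is a parking assortment for $\mathbf{y}$ if all cars can park; the set of these is $\mathsf{PA}_n(\mathbf{y})$. A parking assortment $\mathbf{x}$ is (permutation) invariant if every permutation of its entries is also in $\mathsf{PA}_n(\mathbf{y})$; $\mathsf{PA}^{\mathrm{inv}}_n(\mathbf{y})$ is the set of invariant parking assortments for $\mathbf{y}$, and $\mathsf{PA}^{\mathrm{inv},\uparrow}_n(\mathbf{y})\subseteq\mathsf{PA}^{\mathrm{inv}}_n(\mathbf{y})$ is its subset of nondecreasing elements. $(1^{n-1},w)$ denotes the vector $(1,\dots,1,w)$ with $n-1$ leading ones, and $\mathbf{b}^\top\mathbf{y}=\sum_{i=1}^n b_iy_i$. -}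

module Defs where

open import Level using (0ℓ)
open import Data.Nat using (ℕ; zero; suc; _+_; _*_; _≤_)
open import Data.Fin using (Fin; zero; suc; toℕ)
open import Data.List.Base as List using (List; applyUpTo; length; _++_)
import Data.List.Relation.Unary.All as List using (All)
open import Data.List.Membership.Propositional using (_∈_; _∉_)
open import Data.List.Relation.Unary.Unique.Propositional using (Unique)
open import Data.List.Relation.Binary.Permutation.Propositional using (_↭_)
open import Data.Vec.Base using (Vec; []; _∷_; _∷ʳ_; sum; zipWith; map; replicate; lookup; toList)
open import Data.Vec.Relation.Unary.All using (All)
open import Data.Vec.Relation.Unary.Linked using (Linked)
open import Data.Product using (∃; _×_)
open import Relation.Nullary using (¬_)
open import Relation.Unary using (Pred; _≐_; _∩_)
open import Relation.Binary.PropositionalEquality using (_≡_)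

private
  variable
    n k : ℕ

-- Spots are the numbers 1, …, m; a street's state is the list of its
-- occupied spots.  A car of length ℓ starting at s takes s, …, s + ℓ - 1.

spots : (s ℓ : ℕ) → List ℕ
spots s ℓ = applyUpTo (s +_) ℓ

-- The bound says s + ℓ - 1 ≤ m without truncated subtraction.

Available : (m : ℕ) (occ : List ℕ) (ℓ s : ℕ) → Set
Available m occ ℓ s = s + ℓ ≤ suc m × List.All (_∉ occ) (spots s ℓ)

-- The rule "park at x if possible, otherwise at the next place that fits"
-- selects the least available s ≥ x in both cases.

record ParksAt (m : ℕ) (occ : List ℕ) (ℓ x s : ℕ) : Set where
  field
    beyond    : x ≤ s
    available : Available m occ ℓ s
    least     : ∀ s′ → x ≤ s′ → Available m occ ℓ s′ → s ≤ s′

data AllPark (m : ℕ) : (occ : List ℕ) (y x : Vec ℕ n) → Set where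
  []  : ∀ {occ} → AllPark m occ [] []
  _∷_ : ∀ {occ ℓ p s} {y x : Vec ℕ n} →
        ParksAt m occ ℓ p s →
        AllPark m (spots s ℓ ++ occ) y x →
        AllPark m occ (ℓ ∷ y) (p ∷ x)

PA : Vec ℕ n → Pred (Vec ℕ n) 0ℓ
PA y x = All (λ p → 1 ≤ p × p ≤ sum y) x × AllPark (sum y) List.[] y x

PAⁱⁿᵛ : Vec ℕ n → Pred (Vec ℕ n) 0ℓ
PAⁱⁿᵛ y x = ∀ x′ → toList x′ ↭ toList x → PA y x′

PAⁱⁿᵛ↑ : Vec ℕ n → Pred (Vec ℕ n) 0ℓ
PAⁱⁿᵛ↑ y = PAⁱⁿᵛ y ∩ Linked _≤_

-- Membership in PA already forces w ≥ 1.

𝒲 : Vec ℕ (suc k) → Pred ℕ 0ℓ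
𝒲 {k} y w = PAⁱⁿᵛ y (replicate k 1 ∷ʳ w)

dot : Vec ℕ n → Vec ℕ n → ℕ
dot b y = sum (zipWith _*_ b y)

-- { 1 + bᵀy : b ∈ {0} × {0,1}ᵏ }, with Fin 2 as {0,1}.

ShiftedSubsetSums : Vec ℕ (suc k) → Pred ℕ 0ℓ
ShiftedSubsetSums {k} y w =
  ∃ λ (b : Vec (Fin 2) k) → w ≡ 1 + dot (0 ∷ map toℕ b) y

NonConstant : Vec ℕ n → Set
NonConstant {n} y = ¬ (∀ (i j : Fin n) → lookup y i ≡ lookup y j)

sumAfter : Vec ℕ n → Fin n → ℕ
sumAfter (_ ∷ y) zero    = sum y
sumAfter (_ ∷ y) (suc j) = sumAfter y j

-- P is finite with exactly c elements.

HasCardinality : {A : Set} → Pred A 0ℓ → ℕ → Set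
HasCardinality {A} P c =
  ∃ λ (xs : List A) → Unique xs × ((_∈ xs) ≐ P) × length xs ≡ c

{-# OPTIONS --safe #-}
-- For x a rearrangement of (1,…,1,w) with w in position i, the cars before i
-- fill an initial segment, car i parks so as to leave a gap of length
-- g = (w − 1) ∸ (y₁ + … + yᵢ₋₁), and the later cars enter this gap greedily.  As
-- the lengths add up to m, all cars park iff the greedy filling is exact.  So
-- w ∈ 𝒲 is a condition on greedy subset-sum representations: each w − 1 is a
-- subset sum of y₂, …, yₙ, for superdecreasing y the greedy algorithm finds every
-- subset sum, and conversely if all 2ⁿ⁻¹ sums are distinct and found greedily,
-- then the total of the lengths after yⱼ (j ≥ 2) must not allow taking yⱼ.
module Submission where

open import Defs
open import Data.Nat
open import Data.Nat.Properties
open import Data.Fin using (Fin; zero; suc; toℕ; inject₁)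
import Data.Fin.Properties as Fin
open import Data.List.Base using (List; []; _∷_; _++_; length; filter; cartesianProductWith; allFin)
import Data.List.Base as List
open import Data.List.Properties using (++-identityʳ; length-map; length-++; length-applyUpTo; length-tabulate; filter-++; filter-all; filter-none)
import Data.List.Relation.Unary.All as ListAll
open import Data.List.Relation.Unary.All.Properties using (All¬⇒¬Any; ¬Any⇒All¬; applyUpTo⁺₁)
open import Data.List.Relation.Unary.Any using (here; there)
open import Data.List.Relation.Unary.AllPairs using ([]; _∷_)
open import Data.List.Relation.Unary.Unique.Propositional using (Unique)
import Data.List.Relation.Unary.Unique.Propositional.Properties as Unique
open import Data.List.Relation.Unary.Unique.DecPropositional.Properties _≟_ using (deduplicate-!)
open import Data.List.Membership.Propositional using (_∈_; _∉_)
open import Data.List.Membership.Propositional.Properties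
open import Data.List.Relation.Binary.Permutation.Propositional using (_↭_; ↭-refl; ↭-sym; ↭-trans; ↭-reflexive; prep; swap; ↭⇒↭ₛ)
open import Data.List.Relation.Binary.Permutation.Propositional.Properties using (All-resp-↭; ∈-resp-↭; ↭-length; drop-∷; shift; ∷↭∷ʳ; ↭-singleton-inv)
import Data.List.Relation.Binary.Permutation.Setoid.Properties as Permutation
open import Data.Vec using (Vec; []; _∷_; _∷ʳ_; sum; replicate; insertAt; init; lookup; map; toList)
open import Data.Vec.Properties using (lookup-replicate; toList-∷ʳ; ∷ʳ-injectiveʳ; insertAt-lookup; ∷-injective)
open import Data.Vec.Relation.Unary.All using (All; []; _∷_)
import Data.Vec.Relation.Unary.All as All
import Data.Vec.Relation.Unary.All.Properties as All
open import Data.Vec.Relation.Unary.Linked as Linked using (Linked; []; [-]; _∷_)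
open import Data.Product using (_×_; ∃; ∃₂; _,_; proj₁; proj₂)
open import Data.Sum using (_⊎_; inj₁; inj₂; [_,_]′)
open import Data.Empty using (⊥; ⊥-elim)
open import Function using (_⇔_; mk⇔; Equivalence; _∘_; id)
open import Relation.Nullary
open import Relation.Nullary.Decidable using (map′)
open import Relation.Unary using (_⊆_; _≐_)
open import Relation.Binary.PropositionalEquality

private
  variable
    X : Set
    n k m P g h v w ℓ s t x p : ℕ
    occ : List ℕ
    y xs : Vec ℕ n

open Equivalence using (to; from)

-- Parking into a gap

-- The cars y, each preferring spot 1, exactly fill a gap of length g lying
-- to the left of all other free spots: a car enters the gap iff it fits.
data Fills : ℕ → Vec ℕ n → Set where
  done : Fills 0 []
  take : Fills g y → Fills (ℓ + g) (ℓ ∷ y)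
  skip : g < ℓ → Fills g y → Fills g (ℓ ∷ y)

-- Position `i` holds the car that prefers spot v + 1. The earlier cars use up spots in front of it,
-- and truncated subtraction records that no gap remains once they cover the first v spots.
FillsAt : ℕ → Vec ℕ n → Fin n → Set
FillsAt v (ℓ ∷ y) zero    = Fills v y
FillsAt v (ℓ ∷ y) (suc i) = FillsAt (v ∸ ℓ) y i

∈-spots⁺ : s ≤ t → t < s + ℓ → t ∈ spots s ℓ
∈-spots⁺ {s} {t} s≤t t<s+ℓ with i , refl ← m≤n⇒∃[o]m+o≡n s≤t =
  ∈-applyUpTo⁺ (s +_) (+-cancelˡ-< s i _ t<s+ℓ)

∈-spots⁻ : t ∈ spots s ℓ → s ≤ t × t < s + ℓ
∈-spots⁻ {s = s} t∈ with i , i<ℓ , refl ← ∈-applyUpTo⁻ (s +_) t∈ =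
  m≤m+n s i , +-monoʳ-< s i<ℓ

-- Where a car of length ℓ preferring x parks on an infinitely long street.
record Settles (occ : List ℕ) (ℓ x t : ℕ) : Set where
  field
    beyond : x ≤ t
    clear  : ListAll.All (_∉ occ) (spots t ℓ)
    least  : ∀ s → x ≤ s → ListAll.All (_∉ occ) (spots s ℓ) → t ≤ s

settles⇒parks : Settles occ ℓ x t → t + ℓ ≤ suc m → ParksAt m occ ℓ x t
settles⇒parks st t+ℓ≤ = record
  { beyond = beyond ; available = t+ℓ≤ , clear ; least = λ s x≤s (_ , c) → least s x≤s c }
  where open Settles st

-- The least clear position lies no further than any available one, so it fits on the street
-- whenever some position does. The finite end thus contributes a single inequality.
parks⇒settles : Settles occ ℓ x t → ParksAt m occ ℓ x s → s ≡ t × t + ℓ ≤ suc m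
parks⇒settles {ℓ = ℓ} {t = t} {s = s} st pk = ≤-antisym (P.least t S.beyond (bound , S.clear)) t≤s , bound
  where
  module S = Settles st
  module P = ParksAt pk
  t≤s = S.least s P.beyond (proj₂ P.available)
  bound = ≤-trans (+-monoˡ-≤ ℓ t≤s) (proj₁ P.available)

allPark-∷ : Settles occ ℓ x t →
            AllPark m occ (ℓ ∷ y) (x ∷ xs) ⇔ (t + ℓ ≤ suc m × AllPark m (spots t ℓ ++ occ) y xs)
allPark-∷ st = mk⇔
  (λ { (pk ∷ ap) → case-parks (parks⇒settles st pk) ap })
  (λ (b , ap) → settles⇒parks st b ∷ ap)
  where
  case-parks : ∀ {s t occ} {y xs : Vec ℕ n} → s ≡ t × t + ℓ ≤ suc m →
               AllPark m (spots s ℓ ++ occ) y xs → t + ℓ ≤ suc m × AllPark m (spots t ℓ ++ occ) y xs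
  case-parks (refl , b) ap = b , ap

Filled : List ℕ → ℕ → Set
Filled occ P = ∀ {s} → 1 ≤ s → s ∈ occ ⇔ s ≤ P

-- From left to right: P occupied spots, a gap of g, a block of h, then only free spots. Spot 0 is
-- exempt because it satisfies s ≤ P without belonging to the street.
Gapped : List ℕ → ℕ → ℕ → ℕ → Set
Gapped occ P g h = ∀ {s} → 1 ≤ s → s ∈ occ ⇔ (s ≤ P ⊎ (P + g < s × s ≤ P + g + h))

first∉ : 1 ≤ ℓ → ListAll.All (_∉ occ) (spots s ℓ) → s ∉ occ
first∉ {suc ℓ} {s = s} _ (s∉ ListAll.∷ _) = subst (_∉ _) (+-identityʳ s) s∉

clear⁺ : (∀ {t} → s ≤ t → t < s + ℓ → t ∉ occ) → ListAll.All (_∉ occ) (spots s ℓ)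
clear⁺ {s} f = applyUpTo⁺₁ (s +_) _ λ {i} i<ℓ → f (m≤m+n s i) (+-monoʳ-< s i<ℓ)

clear⁻ : ListAll.All (_∉ occ) (spots s ℓ) → s ≤ t → t < s + ℓ → t ∉ occ
clear⁻ {s = s} c s≤t t<s+ℓ = ListAll.lookup c (∈-spots⁺ s≤t t<s+ℓ)

-- P + (v ∸ P) is the maximum of P and v, which treats a preference inside the filled segment and
-- one beyond it together.
settles-filled : 1 ≤ ℓ → Filled occ P → Settles occ ℓ (suc v) (suc (P + (v ∸ P)))
settles-filled {P = P} {v} 1≤ℓ F = record
  { beyond = s≤s (m≤n+m∸n v P)
  ; clear  = clear⁺ λ t≥ _ t∈ → <⇒≱ (≤-trans (s≤s (m≤m+n P _)) t≥) (to (F (≤-trans (s≤s z≤n) t≥)) t∈)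
  ; least  = λ s v<s c → least v<s (≰⇒> (first∉ 1≤ℓ c ∘ from (F (≤-trans (s≤s z≤n) v<s)))) }
  where
  least : ∀ {s} → v < s → P < s → P + (v ∸ P) < s
  least v<s P<s with ≤-total v P
  ... | inj₁ v≤P rewrite m≤n⇒m∸n≡0 v≤P | +-identityʳ P = P<s
  ... | inj₂ P≤v rewrite m+[n∸m]≡n P≤v = v<s

settles-gap : 1 ≤ ℓ → Gapped occ P (ℓ + g) h → Settles occ ℓ 1 (suc P)
settles-gap {ℓ} {P = P} {g} 1≤ℓ G = record
  { beyond = s≤s z≤n
  ; clear  = clear⁺ λ {t} P<t t≤ t∈ →
      [ <⇒≱ P<t
      , (λ (lt , _) → <⇒≱ (≤-<-trans (+-monoʳ-≤ P (m≤m+n ℓ g)) lt) (s≤s⁻¹ t≤)) ]′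
      (to (G (≤-trans (s≤s z≤n) P<t)) t∈)
  ; least  = λ s 1≤s c → ≰⇒> (first∉ 1≤ℓ c ∘ from (G 1≤s) ∘ inj₁) }

settles-beyond : 1 ≤ h → g < ℓ → Gapped occ P g h → Settles occ ℓ 1 (suc (P + g + h))
settles-beyond {h} {g} {ℓ} {P = P} 1≤h g<ℓ G = record
  { beyond = s≤s z≤n
  ; clear  = clear⁺ λ {t} t> _ t∈ →
      [ <⇒≱ (≤-<-trans (≤-trans (m≤m+n P g) (m≤m+n (P + g) h)) t>)
      , (λ (_ , t≤) → <⇒≱ t> t≤) ]′
      (to (G (≤-trans (s≤s z≤n) t>)) t∈)
  ; least  = λ s 1≤s c → ≰⇒> λ s≤ → first∉ (≤-trans (s≤s z≤n) g<ℓ) c (from (G 1≤s) (inj₂ (past-gap s 1≤s c , s≤))) }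
  where
  -- A start after P but not after P + g would make the car cover P + g + 1, the first spot of the
  -- block, which is nonempty.
  past-gap : ∀ s → 1 ≤ s → ListAll.All (_∉ _) (spots s ℓ) → P + g < s
  past-gap s 1≤s c = ≰⇒> λ s≤ → clear⁻ c (m≤n⇒m≤1+n s≤) reach
    (from (G (s≤s z≤n)) (inj₂ (≤-refl , subst (_≤ P + g + h) (+-comm (P + g) 1) (+-monoʳ-≤ (P + g) 1≤h))))
    where
    P<s : P < s
    P<s = ≰⇒> (first∉ (≤-trans (s≤s z≤n) g<ℓ) c ∘ from (G 1≤s) ∘ inj₁)
    reach : suc (P + g) < s + ℓ
    reach = subst (_≤ s + ℓ) (cong suc (+-suc P g)) (+-mono-≤ P<s g<ℓ)

∈-park⁻ : s ∈ spots (suc t) ℓ ++ occ → (t < s × s ≤ t + ℓ) ⊎ s ∈ occ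
∈-park⁻ {t = t} {ℓ} s∈ with ∈-++⁻ (spots (suc t) ℓ) s∈
... | inj₁ p = let lo , hi = ∈-spots⁻ p in inj₁ (lo , s≤s⁻¹ hi)
... | inj₂ q = inj₂ q

∈-park⁺ˡ : t < s → s ≤ t + ℓ → s ∈ spots (suc t) ℓ ++ occ
∈-park⁺ˡ lo hi = ∈-++⁺ˡ (∈-spots⁺ lo (s≤s hi))

filled-filled : Filled occ P → Filled (spots (suc P) ℓ ++ occ) (P + ℓ)
filled-filled {P = P} {ℓ} F {s} 1≤s = mk⇔ ⇒ ⇐
  where
  ⇒ : s ∈ _ → s ≤ P + ℓ
  ⇒ s∈ with ∈-park⁻ s∈
  ... | inj₁ (_ , hi) = hi
  ... | inj₂ q        = ≤-trans (to (F 1≤s) q) (m≤m+n P ℓ)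
  ⇐ : s ≤ P + ℓ → s ∈ _
  ⇐ hi with s ≤? P
  ... | yes s≤P = ∈-++⁺ʳ _ (from (F 1≤s) s≤P)
  ... | no  s≰P = ∈-park⁺ˡ (≰⇒> s≰P) hi

filled-gapped : Filled occ P → Gapped (spots (suc (P + g)) ℓ ++ occ) P g ℓ
filled-gapped {P = P} {g} {ℓ} F {s} 1≤s = mk⇔ ⇒ ⇐
  where
  ⇒ : s ∈ _ → _
  ⇒ s∈ with ∈-park⁻ s∈
  ... | inj₁ r = inj₂ r
  ... | inj₂ q = inj₁ (to (F 1≤s) q)
  ⇐ : (s ≤ P ⊎ (P + g < s × s ≤ P + g + ℓ)) → s ∈ _
  ⇐ (inj₁ s≤P)       = ∈-++⁺ʳ _ (from (F 1≤s) s≤P)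
  ⇐ (inj₂ (lo , hi)) = ∈-park⁺ˡ lo hi

gapped-take : Gapped occ P (ℓ + g) h → Gapped (spots (suc P) ℓ ++ occ) (P + ℓ) g h
gapped-take {P = P} {ℓ} {g} {h} G {s} 1≤s rewrite +-assoc P ℓ g = mk⇔ ⇒ ⇐
  where
  ⇒ : s ∈ _ → _
  ⇒ s∈ with ∈-park⁻ s∈
  ... | inj₁ (_ , hi) = inj₁ hi
  ... | inj₂ q with to (G 1≤s) q
  ...   | inj₁ s≤P = inj₁ (≤-trans s≤P (m≤m+n P ℓ))
  ...   | inj₂ r   = inj₂ r
  ⇐ : (s ≤ P + ℓ ⊎ (P + (ℓ + g) < s × s ≤ P + (ℓ + g) + h)) → s ∈ _
  ⇐ (inj₂ r) = ∈-++⁺ʳ _ (from (G 1≤s) (inj₂ r))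
  ⇐ (inj₁ hi) with s ≤? P
  ... | yes s≤P = ∈-++⁺ʳ _ (from (G 1≤s) (inj₁ s≤P))
  ... | no  s≰P = ∈-park⁺ˡ (≰⇒> s≰P) hi

gapped-skip : Gapped occ P g h → Gapped (spots (suc (P + g + h)) ℓ ++ occ) P g (h + ℓ)
gapped-skip {P = P} {g} {h} {ℓ} G {s} 1≤s rewrite sym (+-assoc (P + g) h ℓ) = mk⇔ ⇒ ⇐
  where
  ⇒ : s ∈ _ → _
  ⇒ s∈ with ∈-park⁻ s∈
  ... | inj₁ (lo , hi) = inj₂ (≤-<-trans (m≤m+n (P + g) h) lo , hi)
  ... | inj₂ q with to (G 1≤s) q
  ...   | inj₁ s≤P       = inj₁ s≤P
  ...   | inj₂ (lo , hi) = inj₂ (lo , ≤-trans hi (m≤m+n (P + g + h) ℓ))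
  ⇐ : (s ≤ P ⊎ (P + g < s × s ≤ P + g + h + ℓ)) → s ∈ _
  ⇐ (inj₁ s≤P) = ∈-++⁺ʳ _ (from (G 1≤s) (inj₁ s≤P))
  ⇐ (inj₂ (lo , hi)) with s ≤? P + g + h
  ... | yes s≤ = ∈-++⁺ʳ _ (from (G 1≤s) (inj₂ (lo , s≤)))
  ... | no  s≰ = ∈-park⁺ˡ (≰⇒> s≰) hi

fills≤sum : {y : Vec ℕ n} → Fills g y → g ≤ sum y
fills≤sum done               = z≤n
fills≤sum (take {ℓ = ℓ} f)   = +-monoʳ-≤ ℓ (fills≤sum f)
fills≤sum (skip {ℓ = ℓ} _ f) = m≤n⇒m≤o+n ℓ (fills≤sum f)

-- Greedy filling is deterministic. The index ℓ + g blocks direct matching on `take`, so the gap is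
-- generalised along with an equation.
fills-take⁻ : Fills (ℓ + g) (ℓ ∷ y) → Fills g y
fills-take⁻ {ℓ} {g} f = inv f refl
  where
  inv : ∀ {g′} {y : Vec ℕ n} → Fills g′ (ℓ ∷ y) → g′ ≡ ℓ + g → Fills g y
  inv (take f)    eq = subst (λ z → Fills z _) (+-cancelˡ-≡ ℓ _ _ eq) f
  inv (skip lt f) refl = ⊥-elim (m+n≮m ℓ g lt)

fills-skip⁻ : g < ℓ → Fills g (ℓ ∷ y) → Fills g y
fills-skip⁻ g<ℓ (take {ℓ = ℓ} f) = ⊥-elim (m+n≮m ℓ _ g<ℓ)
fills-skip⁻ g<ℓ (skip _ f)       = f

-- The cars still to come are exactly as long as the free spots, so they
-- all park iff none of the gap is wasted.
allPark-gapped : {y : Vec ℕ n} → 1 ≤ h → All (1 ≤_) y → P + g + h ≤ m → m ≡ P + h + sum y →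
                 Gapped occ P g h → AllPark m occ y (replicate n 1) ⇔ Fills g y
allPark-gapped {h = h} {P} {g} {m} {y = []} _ _ fit total _ = mk⇔ (λ _ → subst (λ z → Fills z []) (sym g≡0) done) (λ _ → [])
  where
  g≡0 : g ≡ 0
  -- With no car left, segment and block make up the whole street, so a gap in between would push
  -- the block past the end.
  g≡0 = n≤0⇒n≡0 (+-cancelˡ-≤ (P + h) g 0 (begin
    P + h + g   ≡⟨ +-assoc P h g ⟩
    P + (h + g) ≡⟨ cong (P +_) (+-comm h g) ⟩
    P + (g + h) ≡⟨ +-assoc P g h ⟨
    P + g + h   ≤⟨ fit ⟩
    m           ≡⟨ total ⟩
    P + h + 0   ∎))
    where open ≤-Reasoning
allPark-gapped {h = h} {P} {g} {m} {y = ℓ ∷ y} 1≤h (1≤ℓ ∷ 1≤y) fit total G with ℓ ≤? g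
... | yes ℓ≤g with g′ , refl ← m≤n⇒∃[o]m+o≡n ℓ≤g = mk⇔
  (λ ap → take (to IH (proj₂ (to (allPark-∷ st) ap))))
  (λ f → from (allPark-∷ st) (s≤s bound , from IH (fills-take⁻ f)))
  where
  st = settles-gap 1≤ℓ G
  bound : P + ℓ ≤ m
  bound = ≤-trans (≤-trans (+-monoʳ-≤ P (m≤m+n ℓ g′)) (m≤m+n _ h)) fit
  total′ : m ≡ P + ℓ + h + sum y
  total′ = begin
    m                     ≡⟨ total ⟩
    P + h + (ℓ + sum y)   ≡⟨ +-assoc (P + h) ℓ (sum y) ⟨
    P + h + ℓ + sum y     ≡⟨ cong (_+ sum y) (trans (+-assoc P h ℓ) (trans (cong (P +_) (+-comm h ℓ)) (sym (+-assoc P ℓ h)))) ⟩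
    P + ℓ + h + sum y     ∎
    where open ≡-Reasoning
  IH = allPark-gapped 1≤h 1≤y (subst (λ z → z + h ≤ m) (sym (+-assoc P ℓ g′)) fit) total′ (gapped-take {ℓ = ℓ} G)
... | no ℓ≰g = mk⇔
  (λ ap → let b , ap′ = to (allPark-∷ st) ap in skip g<ℓ (to (IH (s≤s⁻¹ b)) ap′))
  (λ f → let f′ = fills-skip⁻ g<ℓ f ; b = bound f′ in from (allPark-∷ st) (s≤s b , from (IH b) f′))
  where
  g<ℓ = ≰⇒> ℓ≰g
  st = settles-beyond 1≤h g<ℓ G
  -- That the skipped car fits behind the block must be derived from the filling: the later cars are
  -- at least as long as the gap, so enough street remains.
  bound : Fills g y → P + g + h + ℓ ≤ m
  bound f = begin
    P + g + h + ℓ       ≡⟨ cong (_+ ℓ) (trans (+-assoc P g h) (trans (cong (P +_) (+-comm g h)) (sym (+-assoc P h g)))) ⟩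
    P + h + g + ℓ       ≡⟨ +-assoc (P + h) g ℓ ⟩
    P + h + (g + ℓ)     ≡⟨ cong (P + h +_) (+-comm g ℓ) ⟩
    P + h + (ℓ + g)     ≤⟨ +-monoʳ-≤ (P + h) (+-monoʳ-≤ ℓ (fills≤sum f)) ⟩
    P + h + (ℓ + sum y) ≡⟨ total ⟨
    m                   ∎
    where open ≤-Reasoning
  total′ : m ≡ P + (h + ℓ) + sum y
  total′ = trans total (trans (sym (+-assoc (P + h) ℓ (sum y))) (cong (_+ sum y) (+-assoc P h ℓ)))
  IH : P + g + h + ℓ ≤ m → _
  IH b = allPark-gapped (≤-trans 1≤h (m≤m+n h ℓ)) 1≤y (subst (_≤ m) (+-assoc (P + g) h ℓ) b) total′ (gapped-skip G)

-- Cars before position `i` only lengthen the filled segment. The car at `i` opens a gap of v ∸ P,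
-- and the cars after it meet a gapped street.
allPark-filled : {y : Vec ℕ (suc k)} → All (1 ≤_) y → m ≡ P + sum y → Filled occ P → ∀ i →
                 AllPark m occ y (insertAt (replicate k 1) i (suc v)) ⇔ FillsAt (v ∸ P) y i
allPark-filled {P = P} {v = v} {y = ℓ ∷ y} (1≤ℓ ∷ 1≤y) total F zero = mk⇔
  (λ ap → let b , ap′ = to (allPark-∷ st) ap in to (gapped (s≤s⁻¹ b)) ap′)
  (λ f → let b = bound f in from (allPark-∷ st) (s≤s b , from (gapped b) f))
  where
  st = settles-filled 1≤ℓ F
  gapped : P + (v ∸ P) + ℓ ≤ _ → _
  gapped b = allPark-gapped 1≤ℓ 1≤y b (trans total (sym (+-assoc P ℓ (sum y)))) (filled-gapped F)
  bound : Fills (v ∸ P) y → P + (v ∸ P) + ℓ ≤ _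
  bound f = begin
    P + (v ∸ P) + ℓ   ≡⟨ +-assoc P _ ℓ ⟩
    P + (v ∸ P + ℓ)   ≡⟨ cong (P +_) (+-comm (v ∸ P) ℓ) ⟩
    P + (ℓ + (v ∸ P)) ≤⟨ +-monoʳ-≤ P (+-monoʳ-≤ ℓ (fills≤sum f)) ⟩
    P + (ℓ + sum y)   ≡⟨ total ⟨
    _                 ∎
    where open ≤-Reasoning
allPark-filled {k = suc k} {m} {P} {occ} {v} {y = ℓ ∷ y} (1≤ℓ ∷ 1≤y) total F (suc i) = mk⇔
  (λ ap → subst (λ z → FillsAt z y i) (sym (∸-+-assoc v P ℓ)) (to IH (proj₂ (to (allPark-∷ st) ap))))
  (λ f → from (allPark-∷ st) (s≤s bound , from IH (subst (λ z → FillsAt z y i) (∸-+-assoc v P ℓ) f)))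
  where
  st : Settles occ ℓ 1 (suc P)
  -- Preferring spot 1 is the case v = 0, where the offset 0 ∸ P vanishes.
  st = subst (Settles occ ℓ 1) (cong suc (trans (cong (P +_) (0∸n≡0 P)) (+-identityʳ P))) (settles-filled 1≤ℓ F)
  total′ = trans total (sym (+-assoc P ℓ (sum y)))
  bound : P + ℓ ≤ m
  bound = subst (P + ℓ ≤_) (sym total′) (m≤m+n (P + ℓ) (sum y))
  IH = allPark-filled 1≤y total′ (filled-filled {ℓ = ℓ} F) i

-- Finite sets as duplicate-free lists

-- Keeping the complement as an explicit remainder lets one induction serve both the length bound
-- and the case of equal lengths.
unique-⊆⇒↭ : {xs zs : List X} → Unique xs → (_∈ xs) ⊆ (_∈ zs) → ∃ λ ys → zs ↭ xs ++ ys
unique-⊆⇒↭ {xs = []} {zs} _ _ = zs , ↭-refl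
unique-⊆⇒↭ {xs = x ∷ xs} {zs} (x∉ ∷ u) xs⊆ with as , bs , refl ← ∈-∃++ (xs⊆ (here refl)) =
  let ys , eq = unique-⊆⇒↭ u rest⊆ in ys , ↭-trans (shift x as bs) (prep x eq)
  where
  rest⊆ : (_∈ xs) ⊆ (_∈ as ++ bs)
  rest⊆ z∈ with ∈-resp-↭ (shift x as bs) (xs⊆ (there z∈))
  ... | here refl = ⊥-elim (All¬⇒¬Any x∉ z∈)
  ... | there q   = q

unique-⊆-length : {xs zs : List X} → Unique xs → (_∈ xs) ⊆ (_∈ zs) → length xs ≤ length zs
unique-⊆-length {xs = xs} {zs} u xs⊆ with ys , eq ← unique-⊆⇒↭ u xs⊆ = begin
  length xs             ≤⟨ m≤m+n _ _ ⟩
  length xs + length ys ≡⟨ length-++ xs ⟨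
  length (xs ++ ys)     ≡⟨ ↭-length eq ⟨
  length zs             ∎
  where open ≤-Reasoning

unique-⊆-full : {xs zs : List X} → Unique xs → (_∈ xs) ⊆ (_∈ zs) → length zs ≤ length xs → zs ↭ xs
unique-⊆-full {xs = xs} {zs} u xs⊆ len with unique-⊆⇒↭ u xs⊆
... | []     , eq = ↭-trans eq (↭-reflexive (++-identityʳ xs))
... | y ∷ ys , eq = ⊥-elim (m+1+n≰m (length xs) (subst (_≤ length xs) (trans (↭-length eq) (length-++ xs)) len))

unique-++⁻-disjoint : (xs : List X) {ys : List X} → Unique (xs ++ ys) → ∀ {z} → z ∈ xs → z ∈ ys → ⊥
unique-++⁻-disjoint (x ∷ xs) (x∉ ∷ u) (here refl) z∈ys = All¬⇒¬Any x∉ (∈-++⁺ʳ xs z∈ys)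
unique-++⁻-disjoint (x ∷ xs) (x∉ ∷ u) (there z∈)  z∈ys = unique-++⁻-disjoint xs u z∈ z∈ys

unique-++⁻ˡ : (xs : List X) {ys : List X} → Unique (xs ++ ys) → Unique xs
unique-++⁻ˡ []       _        = []
unique-++⁻ˡ (x ∷ xs) (x∉ ∷ u) = ¬Any⇒All¬ xs (All¬⇒¬Any x∉ ∘ ∈-++⁺ˡ) ∷ unique-++⁻ˡ xs u

unique-resp-↭ : {xs ys : List X} → xs ↭ ys → Unique xs → Unique ys
unique-resp-↭ eq = Permutation.Unique-resp-↭ (setoid _) (↭⇒↭ₛ eq)

length-cartesianProductWith : ∀ {Y Z : Set} (f : X → Y → Z) xs ys →
                              length (cartesianProductWith f xs ys) ≡ length xs * length ys
length-cartesianProductWith f []       ys = refl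
length-cartesianProductWith f (x ∷ xs) ys = trans (length-++ (List.map (f x) ys))
  (cong₂ _+_ (length-map (f x) ys) (length-cartesianProductWith f xs ys))

-- Vectors with at most one entry different from 1

ones : ∀ k → Vec ℕ k
ones k = replicate k 1

insertAt-↭ : (xs : Vec ℕ n) (i : Fin (suc n)) (w : ℕ) → toList (insertAt xs i w) ↭ w ∷ toList xs
insertAt-↭ xs       zero    w = ↭-refl
insertAt-↭ (x ∷ xs) (suc i) w = ↭-trans (prep x (insertAt-↭ xs i w)) (swap x w ↭-refl)

∷ʳ-↭ : (xs : Vec ℕ n) (w : ℕ) → toList (xs ∷ʳ w) ↭ w ∷ toList xs
∷ʳ-↭ xs w = ↭-trans (↭-reflexive (toList-∷ʳ w xs)) (↭-sym (∷↭∷ʳ w (toList xs)))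

insertAt-↭-∷ʳ : (i : Fin (suc k)) (w : ℕ) → toList (insertAt (ones k) i w) ↭ toList (ones k ∷ʳ w)
insertAt-↭-∷ʳ i w = ↭-trans (insertAt-↭ _ i w) (↭-sym (∷ʳ-↭ _ w))

All-1⇒ones : (xs : Vec ℕ n) → All (_≡ 1) xs → xs ≡ ones n
All-1⇒ones []       []          = refl
All-1⇒ones (_ ∷ xs) (refl ∷ eq) = cong (1 ∷_) (All-1⇒ones xs eq)

ones-1 : ∀ k → ListAll.All (_≡ 1) (toList (ones k))
ones-1 zero    = ListAll.[]
ones-1 (suc k) = refl ListAll.∷ ones-1 k

-- Either the head is w and only ones are left, or the head is a 1 and cancels on both sides.
↭⇒insertAt : (xs : Vec ℕ (suc k)) → toList xs ↭ w ∷ toList (ones k) → ∃ λ i → xs ≡ insertAt (ones k) i w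
↭⇒insertAt {zero} (z ∷ []) eq with refl ← ↭-singleton-inv eq = zero , refl
↭⇒insertAt {suc k} {w} (z ∷ xs) eq with ∈-resp-↭ eq (here refl)
... | here refl = zero , cong (z ∷_) (All-1⇒ones xs (All.toList⁻ (All-resp-↭ (↭-sym (drop-∷ eq)) (ones-1 (suc k)))))
... | there z∈ with refl ← ListAll.lookup (ones-1 (suc k)) z∈
  with i , xs≡ ← ↭⇒insertAt xs (drop-∷ (↭-trans eq (swap w 1 ↭-refl))) = suc i , cong (1 ∷_) xs≡

↭-∷ʳ⇒insertAt : (xs : Vec ℕ (suc k)) → toList xs ↭ toList (ones k ∷ʳ w) → ∃ λ i → xs ≡ insertAt (ones k) i w
↭-∷ʳ⇒insertAt xs eq = ↭⇒insertAt xs (↭-trans eq (∷ʳ-↭ _ _))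

insertAt-1 : (i : Fin (suc k)) → insertAt (ones k) i 1 ≡ ones (suc k)
insertAt-1         zero    = refl
insertAt-1 {suc k} (suc i) = cong (1 ∷_) (insertAt-1 i)

-- Inserting a 1 gives the same vector at every position, hence the offset 2.
insertAt-injective : {i j : Fin (suc k)} → insertAt (ones k) i (2 + v) ≡ insertAt (ones k) j (2 + w) → v ≡ w × i ≡ j
insertAt-injective {i = zero}  {zero}  refl = refl , refl
insertAt-injective {suc k} {i = zero}  {suc j} ()
insertAt-injective {suc k} {i = suc i} {zero}  ()
insertAt-injective {suc k} {i = suc i} {suc j} eq with refl , refl ← insertAt-injective (proj₂ (∷-injective eq)) = refl , refl

All-insertAt : {Q : ℕ → Set} {xs : Vec ℕ n} (i : Fin (suc n)) → Q w → All Q xs → All Q (insertAt xs i w)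
All-insertAt zero    q qs       = q ∷ qs
All-insertAt (suc i) q (r ∷ qs) = r ∷ All-insertAt i q qs

-- The smaller of the two entries is singled out because the refutation lets the first car prefer p
-- and needs q to be no smaller.
data TwoLarge : Vec ℕ n → Set where
  two : ∀ {p q} {x : Vec ℕ (2 + k)} {zs : Vec ℕ k} →
        1 < p → p ≤ q → toList x ↭ p ∷ q ∷ toList zs → TwoLarge x

ones-or-large : (x : Vec ℕ (suc k)) → All (1 ≤_) x →
                x ≡ ones (suc k) ⊎ ∃₂ λ q (zs : Vec ℕ k) → 1 < q × toList x ↭ q ∷ toList zs
ones-or-large (z ∷ x) (1≤z ∷ 1≤x) with 1 ≟ z
... | no 1≢z = inj₂ (z , x , ≤∧≢⇒< 1≤z 1≢z , ↭-refl)
ones-or-large (z ∷ [])          _           | yes refl = inj₁ refl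
ones-or-large (z ∷ x@(_ ∷ _)) (_ ∷ 1≤x) | yes refl with ones-or-large x 1≤x
... | inj₁ eq                  = inj₁ (cong (1 ∷_) eq)
... | inj₂ (q , zs , 1<q , eq) = inj₂ (q , 1 ∷ zs , 1<q , ↭-trans (prep 1 eq) (swap 1 q ↭-refl))

insertAt-or-two : (x : Vec ℕ (suc k)) → All (1 ≤_) x → (∃₂ λ i w → x ≡ insertAt (ones k) i w) ⊎ TwoLarge x
insertAt-or-two (z ∷ []) _ = inj₁ (zero , z , refl)
insertAt-or-two (z ∷ x@(_ ∷ _)) (1≤z ∷ 1≤x) with 1 ≟ z
... | yes refl = [ (λ (i , w , eq) → inj₁ (suc i , w , cong (1 ∷_) eq)) , inj₂ ∘ add-one ]′ (insertAt-or-two x 1≤x)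
  where
  add-one : {x : Vec ℕ n} → TwoLarge x → TwoLarge (1 ∷ x)
  add-one (two {p = p} {q} {zs = zs} 1<p p≤q eq) =
    two {zs = 1 ∷ zs} 1<p p≤q (↭-trans (prep 1 eq) (↭-trans (swap 1 p ↭-refl) (prep p (swap 1 q ↭-refl))))
... | no 1≢z with ones-or-large x 1≤x
...   | inj₁ refl = inj₁ (zero , z , refl)
...   | inj₂ (q , zs , 1<q , eq) with ≤-total z q
...     | inj₁ z≤q = inj₂ (two {zs = zs} (≤∧≢⇒< 1≤z 1≢z) z≤q (prep z eq))
...     | inj₂ q≤z = inj₂ (two {zs = zs} 1<q q≤z (↭-trans (prep z eq) (swap z q ↭-refl)))

sorted⇒last : (i : Fin (suc k)) → 1 ≤ w → Linked _≤_ (insertAt (ones k) i w) → insertAt (ones k) i w ≡ ones k ∷ʳ w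
sorted⇒last {zero}  zero    _   _ = refl
-- An entry w in front of a 1 must equal 1 in a sorted vector, and then its position is immaterial.
sorted⇒last {suc k} zero    1≤w (w≤1 ∷ _) with refl ← ≤-antisym w≤1 1≤w = ones-∷ʳ (suc k)
  where
  ones-∷ʳ : ∀ k → 1 ∷ ones k ≡ ones k ∷ʳ 1
  ones-∷ʳ zero    = refl
  ones-∷ʳ (suc k) = cong (1 ∷_) (ones-∷ʳ k)
sorted⇒last {suc k} (suc i) 1≤w lk = cong (1 ∷_) (sorted⇒last i 1≤w (Linked.tail lk))

∷ʳ-sorted : ∀ k → 1 ≤ w → Linked _≤_ (ones k ∷ʳ w)
∷ʳ-sorted zero          _   = [-]
∷ʳ-sorted (suc zero)    1≤w = 1≤w ∷ [-]
∷ʳ-sorted (suc (suc k)) 1≤w = ≤-refl ∷ ∷ʳ-sorted (suc k) 1≤w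

-- Subset sums

-- Repeated sums are kept, so the length is always 2 ^ n and distinctness becomes the separate
-- statement `Unique`.
subsetSums : Vec ℕ n → List ℕ
subsetSums []      = 0 ∷ []
subsetSums (ℓ ∷ y) = subsetSums y ++ List.map (ℓ +_) (subsetSums y)

length-subsetSums : (y : Vec ℕ n) → length (subsetSums y) ≡ 2 ^ n
length-subsetSums [] = refl
length-subsetSums {suc n} (ℓ ∷ y) = trans (length-++ (subsetSums y))
  (cong₂ _+_ (length-subsetSums y) (trans (length-map (ℓ +_) (subsetSums y)) (trans (length-subsetSums y) (sym (+-identityʳ _)))))

dot∈subsetSums : (b : Vec (Fin 2) n) (y : Vec ℕ n) → dot (map toℕ b) y ∈ subsetSums y
dot∈subsetSums []             []      = here refl
dot∈subsetSums (zero ∷ b)     (ℓ ∷ y) = ∈-++⁺ˡ (dot∈subsetSums b y)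
dot∈subsetSums (suc zero ∷ b) (ℓ ∷ y) rewrite *-identityˡ ℓ = ∈-++⁺ʳ _ (∈-map⁺ (ℓ +_) (dot∈subsetSums b y))

∈subsetSums⇒dot : (y : Vec ℕ n) → v ∈ subsetSums y → ∃ λ (b : Vec (Fin 2) n) → v ≡ dot (map toℕ b) y
∈subsetSums⇒dot []      (here refl) = [] , refl
∈subsetSums⇒dot (ℓ ∷ y) v∈ with ∈-++⁻ (subsetSums y) v∈
... | inj₁ v∈y = let b , eq = ∈subsetSums⇒dot y v∈y in zero ∷ b , eq
... | inj₂ v∈ℓ with u , u∈ , refl ← ∈-map⁻ (ℓ +_) v∈ℓ =
  let b , eq = ∈subsetSums⇒dot y u∈ in suc zero ∷ b , cong₂ _+_ (sym (*-identityˡ ℓ)) eq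

shifted : Vec ℕ (suc k) → List ℕ
shifted (_ ∷ y) = List.map suc (subsetSums y)

shifted≐ : (y : Vec ℕ (suc k)) → (_∈ shifted y) ≐ ShiftedSubsetSums y
shifted≐ (ℓ ∷ y) =
  (λ w∈ → let v , v∈ , eq = ∈-map⁻ suc w∈ ; b , v≡ = ∈subsetSums⇒dot y v∈ in b , trans eq (cong suc v≡)) ,
  (λ { (b , refl) → ∈-map⁺ suc (dot∈subsetSums b y) })

length-shifted : (y : Vec ℕ (suc k)) → length (shifted y) ≡ 2 ^ k
length-shifted (_ ∷ y) = trans (length-map suc (subsetSums y)) (length-subsetSums y)

subsetSums≤sum : (y : Vec ℕ n) → v ∈ subsetSums y → v ≤ sum y
subsetSums≤sum []      (here refl) = ≤-refl
subsetSums≤sum (ℓ ∷ y) v∈ with ∈-++⁻ (subsetSums y) v∈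
... | inj₁ v∈y = m≤n⇒m≤o+n ℓ (subsetSums≤sum y v∈y)
... | inj₂ v∈ℓ with u , u∈ , refl ← ∈-map⁻ (ℓ +_) v∈ℓ = +-monoʳ-≤ ℓ (subsetSums≤sum y u∈)

sum∈subsetSums : (y : Vec ℕ n) → sum y ∈ subsetSums y
sum∈subsetSums []      = here refl
sum∈subsetSums (ℓ ∷ y) = ∈-++⁺ʳ _ (∈-map⁺ (ℓ +_) (sum∈subsetSums y))

fills⇒∈ : {y : Vec ℕ n} → Fills v y → v ∈ subsetSums y
fills⇒∈ done               = here refl
fills⇒∈ (take {ℓ = ℓ} f)   = ∈-++⁺ʳ _ (∈-map⁺ (ℓ +_) (fills⇒∈ f))
fills⇒∈ (skip {ℓ = ℓ} _ f) = ∈-++⁺ˡ (fills⇒∈ f)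

fills-0 : {y : Vec ℕ n} → All (1 ≤_) y → Fills 0 y
fills-0 []       = done
fills-0 (p ∷ ps) = skip p (fills-0 ps)

fillsAt-0 : {y : Vec ℕ n} → All (1 ≤_) y → ∀ i → FillsAt 0 y i
fillsAt-0 (_ ∷ ps)             zero    = fills-0 ps
fillsAt-0 (_∷_ {x = ℓ} _ ps) (suc i) rewrite 0∸n≡0 ℓ = fillsAt-0 ps i

fills? : ∀ g (y : Vec ℕ n) → Dec (Fills g y)
fills? zero    [] = yes done
fills? (suc g) [] = no λ ()
fills? g (ℓ ∷ y) with ℓ ≤? g
... | no ℓ≰g = map′ (skip (≰⇒> ℓ≰g)) (fills-skip⁻ (≰⇒> ℓ≰g)) (fills? g y)
... | yes ℓ≤g with g′ , refl ← m≤n⇒∃[o]m+o≡n ℓ≤g = map′ take fills-take⁻ (fills? g′ y)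

fillsAt? : ∀ v (y : Vec ℕ n) i → Dec (FillsAt v y i)
fillsAt? v (ℓ ∷ y) zero    = fills? v y
fillsAt? v (ℓ ∷ y) (suc i) = fillsAt? (v ∸ ℓ) y i

-- The set 𝒲

-- The rearrangements of the vector are exactly the insertions of w at the positions `i`, and each
-- of them starts from an empty street, the case P = 0.
𝒲-suc : {y : Vec ℕ (suc k)} → All (1 ≤_) y → 𝒲 y (suc v) ⇔ (∀ i → FillsAt v y i)
𝒲-suc {k} {v} {y} 1≤y = mk⇔ ⇒ ⇐
  where
  filled : Filled [] 0
  filled 1≤s = mk⇔ (λ ()) (λ s≤0 → ⊥-elim (<⇒≱ 1≤s s≤0))
  park : ∀ i → AllPark (sum y) [] y (insertAt (ones k) i (suc v)) ⇔ FillsAt v y i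
  park = allPark-filled 1≤y refl filled
  ⇒ : 𝒲 y (suc v) → ∀ i → FillsAt v y i
  ⇒ 𝓌 i = to (park i) (proj₂ (𝓌 _ (insertAt-↭-∷ʳ i (suc v))))
  -- The case with w first already puts w on the street: the later cars are at least as long as the
  -- gap v, and the first car has positive length.
  bounded : {y : Vec ℕ (suc k)} → All (1 ≤_) y → FillsAt v y zero → v < sum y
  bounded (1≤ℓ ∷ _) f = +-mono-≤ 1≤ℓ (fills≤sum f)
  ⇐ : (∀ i → FillsAt v y i) → 𝒲 y (suc v)
  ⇐ f x′ eq with i , refl ← ↭-∷ʳ⇒insertAt x′ eq =
    All-insertAt i (s≤s z≤n , bounded 1≤y (f zero)) (All.lookup⁻ λ j → subst (λ z → 1 ≤ z × z ≤ sum y) (sym (lookup-replicate j 1))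
      (≤-refl , ≤-trans (s≤s z≤n) (bounded 1≤y (f zero)))) ,
    from (park i) (f i)

¬𝒲-0 : {y : Vec ℕ (suc k)} → ¬ 𝒲 y 0
¬𝒲-0 {k} 𝓌 with (() , _) ∷ _ ← proj₁ (𝓌 _ (insertAt-↭-∷ʳ zero 0))

𝒲-1 : {y : Vec ℕ (suc k)} → All (1 ≤_) y → 𝒲 y 1
𝒲-1 1≤y = from (𝒲-suc 1≤y) (fillsAt-0 1≤y)

𝒲? : {y : Vec ℕ (suc k)} → All (1 ≤_) y → ∀ w → Dec (𝒲 y w)
𝒲?         1≤y zero    = no ¬𝒲-0
𝒲? {y = y} 1≤y (suc v) = map′ (from (𝒲-suc 1≤y)) (to (𝒲-suc 1≤y)) (Fin.all? (fillsAt? v y))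

𝒲⊆shifted : {y : Vec ℕ (suc k)} → All (1 ≤_) y → 𝒲 y ⊆ (_∈ shifted y)
𝒲⊆shifted {y = ℓ ∷ y} 1≤y {zero}  𝓌 = ⊥-elim (¬𝒲-0 𝓌)
𝒲⊆shifted {y = ℓ ∷ y} 1≤y {suc v} 𝓌 = ∈-map⁺ suc (fills⇒∈ (to (𝒲-suc 1≤y) 𝓌 zero))

𝒲-finite : {y : Vec ℕ (suc k)} → All (1 ≤_) y → ∃ λ c → HasCardinality (𝒲 y) c × c ≤ 2 ^ k
𝒲-finite {k} {y} 1≤y = length ws , (ws , unique , (in⁻ , in⁺) , refl) ,
  subst (length ws ≤_) (length-shifted y) (unique-⊆-length unique (λ w∈ → 𝒲⊆shifted 1≤y (in⁻ w∈)))
  where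
  -- Subset sums may coincide, so duplicates are removed before filtering.
  ws = filter (𝒲? 1≤y) (List.deduplicate _≟_ (shifted y))
  unique : Unique ws
  unique = Unique.filter⁺ (𝒲? 1≤y) (deduplicate-! (shifted y))
  in⁻ : (_∈ ws) ⊆ 𝒲 y
  in⁻ w∈ = proj₂ (∈-filter⁻ (𝒲? 1≤y) {xs = List.deduplicate _≟_ (shifted y)} w∈)
  in⁺ : 𝒲 y ⊆ (_∈ ws)
  in⁺ 𝓌 = ∈-filter⁺ (𝒲? 1≤y) (∈-deduplicate⁺ _≟_ (𝒲⊆shifted 1≤y 𝓌)) 𝓌

-- The upper bound for non-constant lengths

-- With w in last position no car follows to fill a gap, so subtracting all the other lengths from v
-- must leave zero.
fillsAt⇒≤sum-init : (y : Vec ℕ (suc k)) → (∀ i → FillsAt v y i) → v ≤ sum (init y)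
fillsAt⇒≤sum-init (ℓ ∷ []) f with done ← f zero = z≤n
fillsAt⇒≤sum-init {v = v} (ℓ ∷ y@(_ ∷ _)) f =
  ≤-trans (m≤n+m∸n v ℓ) (+-monoʳ-≤ ℓ (fillsAt⇒≤sum-init y (f ∘ suc)))

-- The first k cars of length a are forced to enter, which leaves a gap of ℓ for the last one. As ℓ
-- is positive, that car has to fill it exactly.
fills-constant⇒≡ : ∀ k {a ℓ} → 1 ≤ ℓ → Fills (ℓ + sum (replicate k a)) (replicate (suc k) a) → ℓ ≡ a
fills-constant⇒≡ zero {a} {ℓ} 1≤ℓ f = inv f (+-identityʳ ℓ)
  where
  inv : Fills g (a ∷ []) → g ≡ ℓ → ℓ ≡ a
  inv (take done)   eq = trans (sym eq) (+-identityʳ a)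
  inv (skip _ done) eq = ⊥-elim (<⇒≢ 1≤ℓ eq)
fills-constant⇒≡ (suc k) {a} {ℓ} 1≤ℓ f = fills-constant⇒≡ k 1≤ℓ (fills-take⁻ (subst (λ z → Fills z (replicate (2 + k) a)) eq f))
  where
  S = sum (replicate k a)
  eq : ℓ + (a + S) ≡ a + (ℓ + S)
  eq = trans (sym (+-assoc ℓ a S)) (trans (cong (_+ S) (+-comm ℓ a)) (+-assoc a ℓ S))

init-replicate : ∀ k (a : ℕ) → init (replicate (suc k) a) ≡ replicate k a
init-replicate zero    a = refl
init-replicate (suc k) a = cong (a ∷_) (init-replicate k a)

-- Subtracting the first length turns the condition into the same one for the tail, which is
-- constant by induction. The condition at position zero then forces the first length to agree.
fillsAt-sum-init⇒constant : (y : Vec ℕ (suc k)) → All (1 ≤_) y → (∀ i → FillsAt (sum (init y)) y i) →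
                            ∃ λ a → y ≡ replicate (suc k) a
fillsAt-sum-init⇒constant (ℓ ∷ []) _ _ = ℓ , refl
fillsAt-sum-init⇒constant {suc k} (ℓ ∷ y@(_ ∷ _)) (1≤ℓ ∷ 1≤y) f
  with a , eq ← fillsAt-sum-init⇒constant y 1≤y (λ i → subst (λ z → FillsAt z y i) (m+n∸m≡n ℓ (sum (init y))) (f (suc i))) =
  a , cong₂ _∷_ (fills-constant⇒≡ k 1≤ℓ (subst₂ (λ S z → Fills (ℓ + S) z)
    (trans (cong (sum ∘ init) eq) (cong sum (init-replicate k a))) eq (f zero))) eq

-- The general bound on v exceeds the claim by one, and its extremal case occurs only for constant
-- lengths.
nonConstant⇒≤ : {y : Vec ℕ (suc k)} → All (1 ≤_) y → NonConstant y → ∀ w → 𝒲 y w → w ≤ sum (init y)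
nonConstant⇒≤ 1≤y nc zero    𝓌 = z≤n
nonConstant⇒≤ {y = y} 1≤y nc (suc v) 𝓌 = ≤∧≢⇒< (fillsAt⇒≤sum-init y f) λ v≡ →
  let a , eq = fillsAt-sum-init⇒constant y 1≤y (subst (λ z → ∀ i → FillsAt z y i) v≡ f)
      at i = trans (cong (λ z → lookup z i) eq) (lookup-replicate i a)
  in nc (λ i j → trans (at i) (sym (at j)))
  where f = to (𝒲-suc 1≤y) 𝓌

-- Superdecreasing lengths

data Superdecreasing : Vec ℕ n → Set where
  []  : Superdecreasing []
  _∷_ : {y : Vec ℕ n} → sum y < ℓ → Superdecreasing y → Superdecreasing (ℓ ∷ y)

superdecreasing⁺ : (y : Vec ℕ (suc k)) → All (1 ≤_) y →
                   (∀ (j : Fin k) → lookup y (inject₁ j) > sumAfter y (inject₁ j)) → Superdecreasing y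
-- The hypothesis omits the last index, where the inequality is 0 < ℓ and comes from positivity.
superdecreasing⁺ (ℓ ∷ [])        (1≤ℓ ∷ _)  _  = 1≤ℓ ∷ []
superdecreasing⁺ (ℓ ∷ y@(_ ∷ _)) (_ ∷ 1≤y) lt = lt zero ∷ superdecreasing⁺ y 1≤y (lt ∘ suc)

superdecreasing⁻ : {y : Vec ℕ n} → Superdecreasing y → ∀ i → lookup y i > sumAfter y i
superdecreasing⁻ (lt ∷ _)  zero    = lt
superdecreasing⁻ (_  ∷ sd) (suc i) = superdecreasing⁻ sd i

-- A sum avoiding ℓ is at most the total of the later lengths, so ℓ does not fit; a sum using ℓ is
-- at least ℓ, so it does. The greedy choice is therefore the right one.
∈⇒fills : {y : Vec ℕ n} → Superdecreasing y → v ∈ subsetSums y → Fills v y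
∈⇒fills [] (here refl) = done
∈⇒fills {y = ℓ ∷ y} (lt ∷ sd) v∈ with ∈-++⁻ (subsetSums y) v∈
... | inj₁ v∈y = skip (≤-<-trans (subsetSums≤sum y v∈y) lt) (∈⇒fills sd v∈y)
... | inj₂ v∈ℓ with u , u∈ , refl ← ∈-map⁻ (ℓ +_) v∈ℓ = take (∈⇒fills sd u∈)

-- Sums without ℓ lie strictly below ℓ and sums with it do not, so the two halves are disjoint.
unique-subsetSums : {y : Vec ℕ n} → Superdecreasing y → Unique (subsetSums y)
unique-subsetSums [] = ListAll.[] ∷ []
unique-subsetSums {y = ℓ ∷ y} (lt ∷ sd) = Unique.++⁺ u (Unique.map⁺ (+-cancelˡ-≡ ℓ _ _) u) λ (v∈y , v∈ℓ) →
  let z , _ , eq = ∈-map⁻ (ℓ +_) v∈ℓ in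
  <⇒≱ lt (≤-trans (m≤m+n ℓ z) (subst (_≤ sum y) eq (subsetSums≤sum y v∈y)))
  where u = unique-subsetSums sd

dot-injective : {y : Vec ℕ n} → Superdecreasing y → (b c : Vec (Fin 2) n) →
                dot (map toℕ b) y ≡ dot (map toℕ c) y → b ≡ c
dot-injective [] [] [] _ = refl
dot-injective {y = ℓ ∷ y} (lt ∷ sd) (zero ∷ b) (zero ∷ c) eq = cong (zero ∷_) (dot-injective sd b c eq)
dot-injective {y = ℓ ∷ y} (lt ∷ sd) (suc zero ∷ b) (suc zero ∷ c) eq =
  cong (suc zero ∷_) (dot-injective sd b c (+-cancelˡ-≡ (1 * ℓ) _ _ eq))
dot-injective {y = ℓ ∷ y} (lt ∷ sd) (zero ∷ b) (suc zero ∷ c) eq = ⊥-elim (<⇒≱ lt (begin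
  ℓ                         ≡⟨ *-identityˡ ℓ ⟨
  1 * ℓ                     ≤⟨ m≤m+n (1 * ℓ) _ ⟩
  1 * ℓ + dot (map toℕ c) y ≡⟨ eq ⟨
  dot (map toℕ b) y         ≤⟨ subsetSums≤sum y (dot∈subsetSums b y) ⟩
  sum y                     ∎))
  where open ≤-Reasoning
dot-injective {y = ℓ ∷ y} (lt ∷ sd) (suc zero ∷ b) (zero ∷ c) eq =
  sym (dot-injective (lt ∷ sd) (zero ∷ c) (suc zero ∷ b) (sym eq))

shifted⊆𝒲 : {y : Vec ℕ (suc k)} → All (1 ≤_) y → Superdecreasing y → (_∈ shifted y) ⊆ 𝒲 y
shifted⊆𝒲 {y = ℓ ∷ y} 1≤y@(_ ∷ 1≤ys) (lt ∷ sd) w∈ with v , v∈ , refl ← ∈-map⁻ suc w∈ = from (𝒲-suc 1≤y) f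
  where
  f : ∀ i → FillsAt v (ℓ ∷ y) i
  f zero    = ∈⇒fills sd v∈
  -- The first car is longer than all later ones together, so it covers the first v spots and no gap
  -- arises.
  f (suc i) rewrite m≤n⇒m∸n≡0 (≤-trans (subsetSums≤sum y v∈) (<⇒≤ lt)) = fillsAt-0 1≤ys i

𝒲-cardinality : {y : Vec ℕ (suc k)} → All (1 ≤_) y → Superdecreasing y → HasCardinality (𝒲 y) (2 ^ k)
𝒲-cardinality {y = y@(_ ∷ _)} 1≤y sd@(_ ∷ sd′) = shifted y , Unique.map⁺ suc-injective (unique-subsetSums sd′) ,
  (shifted⊆𝒲 1≤y sd , 𝒲⊆shifted 1≤y) , length-shifted y

-- The other parking assortments

Within : ℕ → List ℕ → Set
Within m occ = (_∈ occ) ⊆ (_∈ spots 1 m)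

unique-spots : ∀ s ℓ → Unique (spots s ℓ)
unique-spots s ℓ = Unique.applyUpTo⁺₁ (s +_) ℓ λ i<j _ eq → <⇒≢ i<j (+-cancelˡ-≡ s _ _ eq)

-- On a full street containing p this count is p - 1, which relates a preference to the cars parked
-- in front of it.
below : ℕ → List ℕ → ℕ
below p occ = length (filter (_<? p) occ)

below-++ : ∀ p xs ys → below p (xs ++ ys) ≡ below p xs + below p ys
below-++ p xs ys = trans (cong length (filter-++ (_<? p) xs ys)) (length-++ (filter (_<? p) xs))

below-all : ∀ p s ℓ → (∀ {t} → t ∈ spots s ℓ → t < p) → below p (spots s ℓ) ≡ ℓ
below-all p s ℓ all = trans (cong length (filter-all (_<? p) (ListAll.tabulate all))) (length-applyUpTo (s +_) ℓ)

below-none : ∀ p s ℓ → p ≤ s → below p (spots s ℓ) ≡ 0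
below-none p s ℓ p≤s = cong length (filter-none (_<? p) {xs = spots s ℓ} (ListAll.tabulate λ t∈ t<p → <⇒≱ t<p (≤-trans p≤s (proj₁ (∈-spots⁻ t∈)))))

park-within : 1 ≤ x → ParksAt m occ ℓ x s → Within m occ → Within m (spots s ℓ ++ occ)
park-within {ℓ = ℓ} {s = s} 1≤x pk inside t∈ with ∈-++⁻ (spots s ℓ) t∈
... | inj₂ q = inside q
... | inj₁ q = let lo , hi = ∈-spots⁻ q in
  ∈-spots⁺ (≤-trans 1≤x (≤-trans beyond lo)) (<-≤-trans hi (proj₁ available))
  where open ParksAt pk

length-park : ∀ S s ℓ occ → S + length (spots s ℓ ++ occ) ≡ ℓ + S + length occ
length-park S s ℓ occ = begin
  S + length (spots s ℓ ++ occ)          ≡⟨ cong (S +_) (length-++ (spots s ℓ)) ⟩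
  S + (length (spots s ℓ) + length occ)  ≡⟨ cong (λ z → S + (z + length occ)) (length-applyUpTo (s +_) ℓ) ⟩
  S + (ℓ + length occ)                   ≡⟨ +-assoc S ℓ (length occ) ⟨
  S + ℓ + length occ                     ≡⟨ cong (_+ length occ) (+-comm S ℓ) ⟩
  ℓ + S + length occ                     ∎
  where open ≡-Reasoning

-- No car extends across an occupied spot p, so the spots below p which get
-- taken are those of the cars selected by b.
allPark-below : {y x : Vec ℕ n} → AllPark m occ y x → All (1 ≤_) x → Unique occ → Within m occ → p ∈ occ →
  ∃₂ λ occ′ (b : Vec (Fin 2) n) → Unique occ′ × Within m occ′ × length occ′ ≡ sum y + length occ ×
    below p occ′ ≡ dot (map toℕ b) y + below p occ × (∀ j → p ≤ lookup x j → lookup b j ≡ zero)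
allPark-below {occ = occ} [] _ u inside _ = occ , [] , u , inside , refl , refl , λ ()
allPark-below {n = suc n} {m} {occ} {p} (_∷_ {ℓ = ℓ} {x₁} {s} {y} {x} pk ap) (1≤x₁ ∷ 1≤x) u inside p∈
  with occ′ , b , u′ , inside′ , len , bel , zer ← allPark-below ap 1≤x
         (Unique.++⁺ (unique-spots s ℓ) u λ (t∈ , t∈occ) → ListAll.lookup (proj₂ (ParksAt.available pk)) t∈ t∈occ)
         (park-within 1≤x₁ pk inside) (∈-++⁺ʳ (spots s ℓ) p∈)
  with s <? p
... | yes s<p = occ′ , suc zero ∷ b , u′ , inside′ , trans len (length-park (sum y) s ℓ occ) , below≡ , zeros
  where
  open ParksAt pk
  D = dot (map toℕ b) y
  all : ∀ {t} → t ∈ spots s ℓ → t < p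
  all t∈ = ≰⇒> λ p≤t → ListAll.lookup (proj₂ available) (∈-spots⁺ (<⇒≤ s<p) (≤-<-trans p≤t (proj₂ (∈-spots⁻ t∈)))) p∈
  below≡ : below p occ′ ≡ 1 * ℓ + D + below p occ
  below≡ = begin
    below p occ′                               ≡⟨ bel ⟩
    D + below p (spots s ℓ ++ occ)             ≡⟨ cong (D +_) (below-++ p (spots s ℓ) occ) ⟩
    D + (below p (spots s ℓ) + below p occ)    ≡⟨ cong (λ z → D + (z + below p occ)) (trans (below-all p s ℓ all) (sym (*-identityˡ ℓ))) ⟩
    D + (1 * ℓ + below p occ)                  ≡⟨ +-assoc D (1 * ℓ) _ ⟨
    D + 1 * ℓ + below p occ                    ≡⟨ cong (_+ below p occ) (+-comm D (1 * ℓ)) ⟩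
    1 * ℓ + D + below p occ                    ∎
    where open ≡-Reasoning
  -- Cars never move backwards, so one preferring p or later is not selected.
  zeros : ∀ j → p ≤ lookup (x₁ ∷ x) j → lookup (suc zero ∷ b) j ≡ zero
  zeros zero    p≤ = ⊥-elim (<⇒≱ s<p (≤-trans p≤ beyond))
  zeros (suc j) p≤ = zer j p≤
... | no s≮p = occ′ , zero ∷ b , u′ , inside′ , trans len (length-park (sum y) s ℓ occ) ,
    trans bel (cong (dot (map toℕ b) y +_) (trans (below-++ p (spots s ℓ) occ) (cong (_+ below p occ) (below-none p s ℓ (≮⇒≥ s≮p))))) , zeros
  where
  zeros : ∀ j → p ≤ lookup (x₁ ∷ x) j → lookup (zero ∷ b) j ≡ zero
  zeros zero    _  = refl
  zeros (suc j) p≤ = zer j p≤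

-- The first car meets an empty street and takes its preferred spot p + 1. In the end the street is
-- full, so the p spots in front of it are exactly those of the selected later cars.
pa⇒subsetSum : {y : Vec ℕ n} {x : Vec ℕ n} → 1 ≤ ℓ → PA (ℓ ∷ y) (suc p ∷ x) →
  ∃ λ (b : Vec (Fin 2) n) → p ≡ dot (map toℕ b) y × (∀ j → suc p ≤ lookup x j → lookup b j ≡ zero)
pa⇒subsetSum {ℓ = ℓ} {p} {y} {x} 1≤ℓ ((_ , _) ∷ 1≤x , ap)
  with fits , ap′ ← to (allPark-∷ (record { beyond = ≤-refl ; clear = clear⁺ (λ _ _ ()) ; least = λ _ le _ → le })) ap
  with occ′ , b , u , inside , len , bel , zer ← allPark-below ap′ (All.map proj₁ 1≤x)
    (Unique.++⁺ (unique-spots (suc p) ℓ) [] λ ())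
    (λ t∈ → [ (λ q → let lo , hi = ∈-spots⁻ q in ∈-spots⁺ (≤-trans (s≤s z≤n) lo) (<-≤-trans hi fits)) , (λ ()) ]′ (∈-++⁻ (spots (suc p) ℓ) t∈))
    (∈-++⁺ˡ (∈-spots⁺ ≤-refl (m<m+n (suc p) 1≤ℓ)))
  = b , trans p≡below (trans bel (trans (cong (dot (map toℕ b) y +_) start) (+-identityʳ _))) , zer
  where
  q = suc p
  start : below q (spots q ℓ ++ []) ≡ 0
  start = trans (below-++ q (spots q ℓ) []) (trans (+-identityʳ _) (below-none q q ℓ ≤-refl))
  -- The final state lists as many distinct spots as the street has.
  full : spots 1 (ℓ + sum y) ↭ occ′
  full = unique-⊆-full u inside (≤-reflexive (trans (length-applyUpTo suc _) (sym (trans len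
    (trans (length-park (sum y) q ℓ []) (+-identityʳ _))))))
  p≤m : p ≤ ℓ + sum y
  p≤m = ≤-trans (m≤m+n p ℓ) (s≤s⁻¹ fits)
  p≡below : p ≡ below q occ′
  p≡below = trans (sym (length-applyUpTo suc p)) (≤-antisym
    (unique-⊆-length (unique-spots 1 p) λ t∈ → let lo , hi = ∈-spots⁻ t∈ in
      ∈-filter⁺ (_<? q) (∈-resp-↭ full (∈-spots⁺ lo (<-≤-trans hi (s≤s p≤m)))) hi)
    (unique-⊆-length (Unique.filter⁺ (_<? q) u) λ t∈ → let t∈occ′ , t<q = ∈-filter⁻ (_<? q) {xs = occ′} t∈ in
      ∈-spots⁺ (proj₁ (∈-spots⁻ (inside t∈occ′))) t<q))

positive⇒selected : (b : Vec (Fin 2) n) (y : Vec ℕ n) → 1 ≤ dot (map toℕ b) y → ∃ λ j → lookup b j ≡ suc zero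
positive⇒selected []             []      ()
positive⇒selected (suc zero ∷ b) (ℓ ∷ y) _  = zero , refl
positive⇒selected (zero ∷ b)     (ℓ ∷ y) lt = let j , eq = positive⇒selected b y lt in suc j , eq

-- With p first, p − 1 is the total length of a set of later cars that depends
-- on y alone; giving the preference q ≥ p to one of them changes the set.
¬two-large : {y x : Vec ℕ n} → All (1 ≤_) y → Superdecreasing y → PAⁱⁿᵛ y x → ¬ TwoLarge x
¬two-large {y = ℓ ∷ y} {x} (1≤ℓ ∷ _) (_ ∷ sd) inv (two {p = suc p} {q} {zs = zs} 1<p p≤q eq)
  with b , p≡ , _ ← pa⇒subsetSum 1≤ℓ (inv (suc p ∷ q ∷ zs) (↭-sym eq))
  -- The smaller large preference exceeds 1, so there are spots in front of the first car and some
  -- later car `j` parks there.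
  with j , bⱼ ← positive⇒selected b y (subst (1 ≤_) p≡ (s≤s⁻¹ 1<p))
  with c , p≡′ , zer ← pa⇒subsetSum 1≤ℓ (inv (suc p ∷ insertAt zs j q) (↭-trans (prep (suc p) (insertAt-↭ zs j q)) (↭-sym eq)))
  -- Both selections have the same total and hence coincide, but `c` omits car `j`, which now
  -- prefers q.
  with refl ← dot-injective sd b c (trans (sym p≡) p≡′)
  with () ← trans (sym bⱼ) (zer j (subst (suc p ≤_) (sym (insertAt-lookup zs j q)) p≤q))

-- Counting the invariant assortments

PAⁱⁿᵛ-insertAt : {y : Vec ℕ (suc k)} (i : Fin (suc k)) → 𝒲 y w → PAⁱⁿᵛ y (insertAt (ones k) i w)
PAⁱⁿᵛ-insertAt {w = w} i 𝓌 x′ eq = 𝓌 x′ (↭-trans eq (insertAt-↭-∷ʳ i w))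

PAⁱⁿᵛ⇒insertAt : {y : Vec ℕ (suc k)} {x : Vec ℕ (suc k)} → All (1 ≤_) y → Superdecreasing y → PAⁱⁿᵛ y x →
                 ∃₂ λ i w → 𝒲 y w × x ≡ insertAt (ones k) i w
PAⁱⁿᵛ⇒insertAt {x = x} 1≤y sd inv with insertAt-or-two x (All.map proj₁ (proj₁ (inv x ↭-refl)))
... | inj₂ tl             = ⊥-elim (¬two-large 1≤y sd inv tl)
... | inj₁ (i , w , refl) = i , w , (λ x′ eq → inv x′ (↭-trans eq (↭-sym (insertAt-↭-∷ʳ i w)))) , refl

PAⁱⁿᵛ↑-cardinality : {y : Vec ℕ (suc k)} → All (1 ≤_) y → Superdecreasing y → HasCardinality (PAⁱⁿᵛ↑ y) (2 ^ k)
PAⁱⁿᵛ↑-cardinality {k} {y} 1≤y sd with ws , u , (in⁻ , in⁺) , len ← 𝒲-cardinality 1≤y sd =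
  List.map (ones k ∷ʳ_) ws , Unique.map⁺ (∷ʳ-injectiveʳ (ones k) (ones k)) u , (⇒ , ⇐) , trans (length-map _ ws) len
  where
  positive : 𝒲 y w → 1 ≤ w
  positive {zero}  𝓌 = ⊥-elim (¬𝒲-0 𝓌)
  positive {suc w} 𝓌 = s≤s z≤n
  ⇒ : (_∈ List.map (ones k ∷ʳ_) ws) ⊆ PAⁱⁿᵛ↑ y
  ⇒ x∈ with w , w∈ , refl ← ∈-map⁻ (ones k ∷ʳ_) x∈ = in⁻ w∈ , ∷ʳ-sorted k (positive (in⁻ w∈))
  ⇐ : PAⁱⁿᵛ↑ y ⊆ (_∈ List.map (ones k ∷ʳ_) ws)
  ⇐ (inv , sorted) with i , w , 𝓌 , refl ← PAⁱⁿᵛ⇒insertAt 1≤y sd inv =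
    subst (_∈ _) (sym (sorted⇒last i (positive 𝓌) sorted)) (∈-map⁺ (ones k ∷ʳ_) (in⁺ 𝓌))

-- Brings the elements of `𝒲` other than 1 into the form that `insertAt-injective` expects.
unshift : (zs : List ℕ) → ListAll.All (2 ≤_) zs → ∃ λ us → zs ≡ List.map (2 +_) us
unshift [] _ = [] , refl
unshift (suc (suc u) ∷ zs) (_ ListAll.∷ 2≤zs) = let us , eq = unshift zs 2≤zs in u ∷ us , cong (2 + u ∷_) eq
unshift (suc zero ∷ zs) (s≤s () ListAll.∷ _)

-- The value w = 1 yields one vector, whatever its position; each of the other 2 ^ k - 1 values
-- yields k + 1 different ones.
PAⁱⁿᵛ-cardinality : {y : Vec ℕ (suc k)} → All (1 ≤_) y → Superdecreasing y →
                    HasCardinality (PAⁱⁿᵛ y) (2 ^ k * suc k ∸ suc k + 1)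
PAⁱⁿᵛ-cardinality {k} {y} 1≤y sd with ws , u , (in⁻ , in⁺) , len ← 𝒲-cardinality 1≤y sd
  with zs , ws↭ ← unique-⊆⇒↭ {xs = 1 ∷ []} (ListAll.[] ∷ []) (λ { (here refl) → in⁺ (𝒲-1 1≤y) })
  with 1∉ ∷ uz ← unique-resp-↭ ws↭ u
  with us , refl ← unshift zs (ListAll.tabulate λ { {zero} w∈ → ⊥-elim (¬𝒲-0 (in⁻ (∈-resp-↭ (↭-sym ws↭) (there w∈))))
                                               ; {suc zero} w∈ → ⊥-elim (All¬⇒¬Any 1∉ w∈)
                                               ; {suc (suc _)} _ → s≤s (s≤s z≤n) })
  = ins , unique , (⇒ , ⇐) , length≡
  where
  f : ℕ → Fin (suc k) → Vec ℕ (suc k)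
  f v i = insertAt (ones k) i (2 + v)
  ins = ones (suc k) ∷ cartesianProductWith f us (allFin (suc k))
  ones≢f : ∀ {k} v (i : Fin (suc k)) → ones (suc k) ≢ insertAt (ones k) i (2 + v)
  ones≢f         v zero    ()
  ones≢f {suc k} v (suc i) eq = ones≢f v i (proj₂ (∷-injective eq))
  unique : Unique ins
  unique = ListAll.tabulate (λ x∈ eq → let v , i , _ , _ , x≡ = ∈-cartesianProductWith⁻ f us (allFin (suc k)) x∈ in ones≢f v i (trans eq x≡))
    ∷ Unique.cartesianProductWith⁺ f insertAt-injective (Unique.map⁻ uz) (Unique.allFin⁺ (suc k))
  ⇒ : (_∈ ins) ⊆ PAⁱⁿᵛ y
  ⇒ (here refl) = subst (PAⁱⁿᵛ y) (insertAt-1 zero) (PAⁱⁿᵛ-insertAt zero (𝒲-1 1≤y))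
  ⇒ (there x∈) with v , i , v∈ , _ , refl ← ∈-cartesianProductWith⁻ f us (allFin (suc k)) x∈ =
    PAⁱⁿᵛ-insertAt i (in⁻ (∈-resp-↭ (↭-sym ws↭) (there (∈-map⁺ (2 +_) v∈))))
  ⇐ : PAⁱⁿᵛ y ⊆ (_∈ ins)
  ⇐ inv with i , w , 𝓌 , refl ← PAⁱⁿᵛ⇒insertAt 1≤y sd inv with ∈-resp-↭ ws↭ (in⁺ 𝓌)
  ... | here refl = here (insertAt-1 i)
  ... | there w∈ with v , v∈ , refl ← ∈-map⁻ (2 +_) w∈ = there (∈-cartesianProductWith⁺ f v∈ (∈-allFin i))
  c = length us
  2^k≡ : 2 ^ k ≡ suc c
  2^k≡ = trans (sym len) (trans (↭-length ws↭) (cong suc (length-map (2 +_) us)))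
  length≡ : length ins ≡ 2 ^ k * suc k ∸ suc k + 1
  length≡ = begin
    suc (length (cartesianProductWith f us (allFin (suc k)))) ≡⟨ cong suc (length-cartesianProductWith f us _) ⟩
    suc (c * length (allFin (suc k)))                         ≡⟨ cong (λ z → suc (c * z)) (length-tabulate {n = suc k} id) ⟩
    suc (c * suc k)                                           ≡⟨ +-comm 1 (c * suc k) ⟩
    c * suc k + 1                                             ≡⟨ cong (_+ 1) (m+n∸m≡n (suc k) (c * suc k)) ⟨
    suc c * suc k ∸ suc k + 1                                 ≡⟨ cong (λ z → z * suc k ∸ suc k + 1) 2^k≡ ⟨
    2 ^ k * suc k ∸ suc k + 1                                 ∎
    where open ≡-Reasoning

-- Consequences of equality

-- The total of the later lengths is a subset sum avoiding ℓ. Were ℓ at most this total, the greedy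
-- filling would take ℓ and represent the same number a second time.
fills⇒superdecreasing : (y : Vec ℕ n) → Unique (subsetSums y) → (∀ {v} → v ∈ subsetSums y → Fills v y) → Superdecreasing y
fills⇒superdecreasing []      _ _ = []
fills⇒superdecreasing (ℓ ∷ y) u f = lt ∷ fills⇒superdecreasing y (unique-++⁻ˡ (subsetSums y) u)
  λ v∈ → fills-skip⁻ (≤-<-trans (subsetSums≤sum y v∈) lt) (f (∈-++⁺ˡ v∈))
  where
  lt : sum y < ℓ
  lt = ≰⇒> λ ℓ≤ → let g , eq = m≤n⇒∃[o]m+o≡n ℓ≤ in
    unique-++⁻-disjoint (subsetSums y) u (sum∈subsetSums y)
      (subst (_∈ List.map (ℓ +_) (subsetSums y)) eq (∈-map⁺ (ℓ +_) (fills⇒∈ (fills-take⁻ (subst (λ z → Fills z (ℓ ∷ y)) (sym eq) (f (∈-++⁺ˡ (sum∈subsetSums y))))))))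

equality⇒ : (y : Vec ℕ (2 + k)) → All (1 ≤_) y → HasCardinality (𝒲 y) (2 ^ suc k) →
  𝒲 y ≐ ShiftedSubsetSums y × lookup y zero ≥ lookup y (suc zero) ×
  (∀ (j : Fin (suc k)) → j ≢ zero → lookup y (inject₁ j) > sumAfter y (inject₁ j))
equality⇒ {k} y@(ℓ ∷ ys@(ℓ₂ ∷ zs)) 1≤y (ws , u , (in⁻ , in⁺) , len) =
  ((λ 𝓌 → proj₁ (shifted≐ y) (𝒲⊆shifted 1≤y 𝓌)) , λ w∈ → all∈𝒲 (proj₂ (shifted≐ y) w∈)) , ℓ₂≤ℓ , tail
  where
  full : shifted y ↭ ws
  -- `𝒲` has as many elements as there are listed sums, so all sums are distinct and all occur.
  full = unique-⊆-full u (λ w∈ → 𝒲⊆shifted 1≤y (in⁻ w∈)) (≤-reflexive (trans (length-shifted y) (sym len)))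
  all∈𝒲 : (_∈ shifted y) ⊆ 𝒲 y
  all∈𝒲 w∈ = in⁻ (∈-resp-↭ full w∈)
  fillsAt : v ∈ subsetSums ys → ∀ i → FillsAt v y i
  fillsAt v∈ = to (𝒲-suc 1≤y) (all∈𝒲 (∈-map⁺ suc v∈))
  ℓ₂≤ℓ : ℓ₂ ≤ ℓ
  -- Take v = sum ys with the large preference second: only `zs` can fill the remaining gap, so sum
  -- ys is at most ℓ + sum zs.
  ℓ₂≤ℓ = +-cancelʳ-≤ (sum zs) ℓ₂ ℓ (≤-trans (m≤n+m∸n (sum ys) ℓ) (+-monoʳ-≤ ℓ (fills≤sum (fillsAt (sum∈subsetSums ys) (suc zero)))))
  sd : Superdecreasing ys
  sd = fills⇒superdecreasing ys (Unique.map⁻ (unique-resp-↭ (↭-sym full) u)) (λ v∈ → fillsAt v∈ zero)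
  tail : ∀ (j : Fin (suc k)) → j ≢ zero → lookup y (inject₁ j) > sumAfter y (inject₁ j)
  tail zero    j≢ = ⊥-elim (j≢ refl)
  tail (suc j) _  = superdecreasing⁻ sd (inject₁ j)

theorem5 : (∀ (k : ℕ) (y : Vec ℕ (suc k)) → All (1 ≤_) y →
    (NonConstant y → ∀ w → 𝒲 y w → w ≤ sum (init y))
    × (𝒲 y ⊆ ShiftedSubsetSums y
    × (∃ λ c → HasCardinality (𝒲 y) c × c ≤ 2 ^ k))
    × ((∀ (j : Fin k) → lookup y (inject₁ j) > sumAfter y (inject₁ j)) →
    𝒲 y ≐ ShiftedSubsetSums y
    × HasCardinality (𝒲 y) (2 ^ k)
    × HasCardinality (PAⁱⁿᵛ y) (2 ^ k * suc k ∸ suc k + 1)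
    × HasCardinality (PAⁱⁿᵛ↑ y) (2 ^ k)))
    × (∀ (k : ℕ) (y : Vec ℕ (suc (suc k))) → All (1 ≤_) y →
    HasCardinality (𝒲 y) (2 ^ suc k) →
    𝒲 y ≐ ShiftedSubsetSums y
    × lookup y zero ≥ lookup y (suc zero)
    × (∀ (j : Fin (suc k)) → j ≢ zero →
    lookup y (inject₁ j) > sumAfter y (inject₁ j)))
theorem5 =
  (λ k y 1≤y →
    nonConstant⇒≤ 1≤y ,
    ((λ 𝓌 → proj₁ (shifted≐ y) (𝒲⊆shifted 1≤y 𝓌)) , 𝒲-finite 1≤y) ,
    λ lt → let sd = superdecreasing⁺ y 1≤y lt in
      ((λ 𝓌 → proj₁ (shifted≐ y) (𝒲⊆shifted 1≤y 𝓌)) , λ w∈ → shifted⊆𝒲 1≤y sd (proj₂ (shifted≐ y) w∈)) ,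
      𝒲-cardinality 1≤y sd , PAⁱⁿᵛ-cardinality 1≤y sd , PAⁱⁿᵛ↑-cardinality 1≤y sd) ,
  λ k y → equality⇒ y
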